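{- Let $n\ge 2$ and let $p,q$ be positive integers with $\gcd(p,q)=1$. Let $A$ be the $n\times n$ integer matrix with columns $a_k=q e_k-p e_{k+1}$ ($1\le k\le n-1$) and $a_n=q e_n+p e_1$. Then for every $i\in\{1,\dots,n\}$, $$\min\{l\in\mathbb{Z}_{\ge1} : l e_i\in A\mathbb{Z}^n\}=p^n+q^n.$$ In particular, if moreover $p\neq q$, there exists a unilateral tiling of $(\mathbb{Z}/(p^n+q^n)\mathbb{Z})^n$ by discrete hypercubes of side lengths $p$ and $q$.
   Context: $e_i$ denotes the $i$-th standard unit vector. Let $N=p^n+q^n$. A discrete hypercube of side length $s$ in $(\mathbb{Z}/N\mathbb{Z})^n$ is the image of a set $x+\{0,1,\dots,s-1\}^n$, $x\in\mathbb{Z}^n$, under reduction modulo $N$. A tiling of $(\mathbb{Z}/N\mathbb{Z})^n$ by such hypercubes is a family of them that partitions $(\mathbb{Z}/N\mathbb{Z})^n$; it is unilateral if no two distinct tiles of the same side length $s$ share a full facet, i.e. there are no two tiles of side $s$ with corners $x,x'$ such that $x'-x\equiv \pm s e_i \pmod N$ for some $i$. -}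

module Defs where

open import Data.Nat.Base using (ℕ; zero; suc)
open import Data.Integer.Base using (ℤ; +_; 0ℤ; 1ℤ; _+_; _-_; _*_; -_; _≤_)
open import Data.Integer.Divisibility.Signed using (_∣_)
import Data.Integer.Properties as ℤ
open import Data.Fin.Base using (Fin; zero; suc; toℕ; inject₁; fromℕ)
open import Data.Fin.Properties using (_≟_)
open import Data.Fin.Relation.Unary.Top using (view; ‵fromℕ; ‵inject₁)
open import Data.Vec.Functional using (Vector)
open import Data.Bool.Base using (if_then_else_)
open import Data.Product.Base using (∃; _×_)
open import Data.Product using (∃!)
open import Data.Sum.Base using (_⊎_)
open import Relation.Nullary using (¬_; does)
open import Relation.Binary.PropositionalEquality using (_≡_; _≢_)
open import Algebra.Bundles using (CommutativeRing)
open import Algebra.Properties.Semiring.Sum (CommutativeRing.semiring ℤ.+-*-commutativeRing) using (sum)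

private
  variable
    n m : ℕ

infixl 6 _⊕_ _⊖_
infixr 7 _•_ _·_
infix  4 _≋_[mod_] _∈_[mod_]

_⊕_ : Vector ℤ n → Vector ℤ n → Vector ℤ n
(v ⊕ w) j = v j + w j

_⊖_ : Vector ℤ n → Vector ℤ n → Vector ℤ n
(v ⊖ w) j = v j - w j

_•_ : ℤ → Vector ℤ n → Vector ℤ n
(l • v) j = l * v j

e : Fin n → Vector ℤ n
e i j = if does (i ≟ j) then 1ℤ else 0ℤ

-- First argument: row index; second argument: column index.
Matrix : ℕ → Set
Matrix n = Fin n → Fin n → ℤ

_·_ : Matrix n → Vector ℤ n → Vector ℤ n
(M · c) j = sum (λ k → M j k * c k)

_∈Image_ : Vector ℤ n → Matrix n → Set
v ∈Image M = ∃ λ c → ∀ j → v j ≡ (M · c) j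

-- Indices 1, …, n are represented by Fin n, so in dimension suc m the last
-- index is fromℕ m, and inject₁ k is any other index, with successor suc k.
column : ℕ → ℕ → (n : ℕ) → Fin n → Vector ℤ n
column p q (suc m) k with view k
... | ‵fromℕ      = (+ q) • e (fromℕ m)   ⊕ (+ p) • e zero
... | ‵inject₁ k′ = (+ q) • e (inject₁ k′) ⊖ (+ p) • e (suc k′)

A : ℕ → ℕ → (n : ℕ) → Matrix n
A p q n j k = column p q n k j

IsMinimum : (ℤ → Set) → ℤ → Set
IsMinimum P x = P x × (∀ l → P l → x ≤ l)

-- (ℤ/Nℤ)ⁿ is represented as the setoid of integer vectors up to
-- coordinatewise congruence modulo N.
_≋_[mod_] : Vector ℤ n → Vector ℤ n → ℕ → Set
v ≋ w [mod N ] = ∀ j → (+ N) ∣ (v j - w j)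

record Hypercube (n : ℕ) : Set where
  constructor hypercube
  field
    corner : Vector ℤ n
    side   : ℕ

open Hypercube public

-- The class of y lies in the image of corner + {0, …, side − 1}ⁿ.
_∈_[mod_] : Vector ℤ n → Hypercube n → ℕ → Set
y ∈ C [mod N ] = ∃ λ (u : Vector (Fin (side C)) _) → y ≋ corner C ⊕ (λ j → + toℕ (u j)) [mod N ]

IsTiling : ℕ → (Fin m → Hypercube n) → Set
IsTiling N T = ∀ y → ∃! _≡_ λ i → y ∈ T i [mod N ]

HasSideLengths : ℕ → ℕ → (Fin m → Hypercube n) → Set
HasSideLengths p q T =
  (∀ i → side (T i) ≡ p ⊎ side (T i) ≡ q)
  × (∃ λ i → side (T i) ≡ p)
  × (∃ λ i → side (T i) ≡ q)

-- Only meaningful for hypercubes of the same side length.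
ShareFacet : ℕ → Hypercube n → Hypercube n → Set
ShareFacet N C D = ∃ λ i →
    (corner D ⊖ corner C ≋ (+ side C) • e i [mod N ])
  ⊎ (corner D ⊖ corner C ≋ (- (+ side C)) • e i [mod N ])

IsUnilateral : ℕ → (Fin m → Hypercube n) → Set
IsUnilateral N T =
  ∀ i j → i ≢ j → side (T i) ≡ side (T j) → ¬ ShareFacet N (T i) (T j)

{-# OPTIONS --safe #-}

-- Write N = pⁿ + qⁿ and W(v) = Σⱼ pⁿ⁻¹⁻ʲ qʲ vⱼ (0 ≤ j < n).  A vector d lies in
-- the lattice A ℤⁿ iff the recursion q xⱼ₊₁ = p xⱼ + dⱼ has an integral solution
-- with xₙ = − x₀, and solving it step by step shows that this happens iff
-- N ∣ W(d).  Since p and q are units modulo N, so is W(eᵢ), hence l eᵢ ∈ A ℤⁿ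
-- iff N ∣ l.
--
-- For the tiling let p < q.  Translates by the lattice of the cube [0,q)ⁿ and of
-- the cube q eₙ + [0,p)ⁿ are pairwise disjoint: an overlap gives a solution of the
-- recursion with small dⱼ, along which the sign of x is preserved, contradicting
-- xₙ = − x₀ (or its shifted analogue).  So W takes pⁿ + qⁿ = N distinct values
-- modulo N on the two cubes together, hence every value exactly once.  Two cubes
-- of equal side s sharing a facet would give N ∣ s W(eᵢ), which is impossible.
module Submission where

open import Defs

open import Algebra.Bundles using (CommutativeRing)
open import Data.Fin.Base using (Fin; zero; suc; inject₁; fromℕ; toℕ; fromℕ<; punchOut; funToFin; finToFun; combine; remQuot; splitAt; join)
open import Data.Fin.Induction using (<-weakInduction)
open import Data.Fin.Properties using (_≟_; any?; toℕ-injective; toℕ-fromℕ<; toℕ<n; punchOut-injective; injective⇒≤; funToFin-finToFin; finToFun-funToFin; remQuot-combine; combine-remQuot; join-splitAt)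
open import Data.Fin.Relation.Unary.Top using (view-fromℕ; view-inject₁)
open import Data.Integer.Base using (ℤ; +_; 0ℤ; 1ℤ; -1ℤ; _+_; _-_; _*_; -_; _^_; _≤_; _<_; +≤+; +<+; NonZero; nonNegative; _%ℕ_; _/ℕ_; ∣_∣)
open import Data.Integer.Coprimality using (coprime-divisor)
open import Data.Integer.Divisibility.Signed hiding (_∣?_)
open import Data.Integer.DivMod using (n%ℕd<d; a≡a%ℕn+[a/ℕn]*n)
open import Data.Integer.Properties hiding (_≟_)
open import Data.Integer.Tactic.RingSolver using (solve-∀)
open import Data.Nat.Base as ℕ using (ℕ; zero; suc)
import Data.Nat.Coprimality as ℕ
import Data.Nat.Divisibility as ℕ
open import Data.Nat.GCD using (gcd)
import Data.Nat.Properties as ℕ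
open import Data.Product.Base using (∃; _×_; _,_; proj₁; proj₂)
open import Data.Sum.Base using (_⊎_; inj₁; inj₂; swap)
open import Data.Vec.Functional using (Vector; _∷_)
open import Function.Base using (_∘_)
open import Function.Definitions using (Injective)
open import Relation.Binary.Definitions using (tri<; tri≈; tri>)
open import Relation.Binary.PropositionalEquality
open import Relation.Nullary using (¬_; yes; no; contradiction)

open import Algebra.Properties.Semiring.Sum (CommutativeRing.semiring +-*-commutativeRing) using (sum; sum-init-last; sum-cong-≗)

private
  variable
    m n : ℕ

-- Cancellation modulo N and coprimality.

-- For N ≠ 0 these `z` are the units modulo N. The cancellation form needs no inverse; it is used
-- with modulus q as well as with pⁿ + qⁿ.
Regular : ℤ → ℤ → Set
Regular N z = ∀ k → N ∣ k * z → N ∣ k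

regular-* : ∀ {N y z} → Regular N y → Regular N z → Regular N (y * z)
regular-* {N} {y} {z} ry rz k h =
  ry k (rz (k * y) (subst (N ∣_) (sym (*-assoc k y z)) h))

regular-1 : ∀ {N} → Regular N 1ℤ
regular-1 {N} k = subst (N ∣_) (*-identityʳ k)

regular-^ : ∀ {N z} → Regular N z → ∀ n → Regular N (z ^ n)
regular-^ rz zero    = regular-1
regular-^ {z = z} rz (suc n) = regular-* {y = z} rz (regular-^ rz n)

coprime⇒regular : ∀ {k l} → ℕ.Coprime k l → Regular (+ k) (+ l)
coprime⇒regular {k} {l} c i h =
  ∣ᵤ⇒∣ (coprime-divisor (+ k) (+ l) i c (∣⇒∣ᵤ (subst (+ k ∣_) (*-comm i (+ l)) h)))

-- A common divisor of `d` and `l` divides both `k` and `l`, so `d` is coprime to `l`; Euclid's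
-- lemma then strips one factor `l` from the power.
coprime-^ʳ : ∀ {k l} → ℕ.Coprime k l → ∀ n → ℕ.Coprime k (l ℕ.^ n)
coprime-^ʳ c zero (_ , d∣1) = ℕ.∣1⇒≡1 d∣1
coprime-^ʳ {k} {l} c (suc n) {d} (d∣k , d∣l^1+n) = coprime-^ʳ c n (d∣k ,
  ℕ.coprime-divisor {d} {l} (λ (x∣d , x∣l) → c (ℕ.∣-trans x∣d d∣k , x∣l)) d∣l^1+n)

pos-^ : ∀ k n → + (k ℕ.^ n) ≡ (+ k) ^ n
pos-^ k zero    = refl
pos-^ k (suc n) = trans (pos-* k (k ℕ.^ n)) (cong (+ k *_) (pos-^ k n))

-- The weight form and the recursion b cⱼ₊₁ = a cⱼ + dⱼ.

-- The weight of v is Σⱼ aᵐ⁻¹⁻ʲ bʲ vⱼ.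
weight : ℤ → ℤ → Vector ℤ m → ℤ
weight {zero}  a b v = 0ℤ
weight {suc m} a b v = a ^ m * v zero + b * weight a b (v ∘ suc)

module _ (a b : ℤ) where
  open ≡-Reasoning

  weight-cong : {v w : Vector ℤ m} → v ≗ w → weight a b v ≡ weight a b w
  weight-cong {zero}  v≗w = refl
  weight-cong {suc m} v≗w =
    cong₂ _+_ (cong (a ^ m *_) (v≗w zero)) (cong (b *_) (weight-cong (v≗w ∘ suc)))

  weight-⊕ : (v w : Vector ℤ m) → weight a b (v ⊕ w) ≡ weight a b v + weight a b w
  weight-⊕ {zero}  v w = refl
  weight-⊕ {suc m} v w = trans
    (cong (λ s → a ^ m * (v zero + w zero) + b * s) (weight-⊕ (v ∘ suc) (w ∘ suc)))
    (distrib (a ^ m) b (v zero) (w zero) (weight a b (v ∘ suc)) (weight a b (w ∘ suc)))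
    where
    distrib : ∀ x y s t s′ t′ → x * (s + t) + y * (s′ + t′) ≡ x * s + y * s′ + (x * t + y * t′)
    distrib = solve-∀

  weight-• : ∀ l (v : Vector ℤ m) → weight a b (l • v) ≡ l * weight a b v
  weight-• {zero}  l v = sym (*-zeroʳ l)
  weight-• {suc m} l v = trans
    (cong (λ s → a ^ m * (l * v zero) + b * s) (weight-• l (v ∘ suc)))
    (distrib (a ^ m) b l (v zero) (weight a b (v ∘ suc)))
    where
    distrib : ∀ x y l s t → x * (l * s) + y * (l * t) ≡ l * (x * s + y * t)
    distrib = solve-∀

  weight-⊖ : (v w : Vector ℤ m) → weight a b (v ⊖ w) ≡ weight a b v - weight a b w
  weight-⊖ v w = begin
    weight a b (v ⊖ w)                     ≡⟨ weight-cong (λ j → cong (λ s → v j + s) (sym (-1*i≡-i (w j)))) ⟩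
    weight a b (v ⊕ -1ℤ • w)               ≡⟨ weight-⊕ v (-1ℤ • w) ⟩
    weight a b v + weight a b (-1ℤ • w)    ≡⟨ cong (_+_ (weight a b v)) (weight-• -1ℤ w) ⟩
    weight a b v + -1ℤ * weight a b w      ≡⟨ cong (_+_ (weight a b v)) (-1*i≡-i (weight a b w)) ⟩
    weight a b v - weight a b w            ∎

  weight-∣ : ∀ {k} {v : Vector ℤ m} → (∀ j → k ∣ v j) → k ∣ weight a b v
  weight-∣ {zero}  k∣v = divides 0ℤ refl
  weight-∣ {suc m} k∣v =
    ∣m∣n⇒∣m+n (∣n⇒∣m*n (a ^ m) (k∣v zero)) (∣n⇒∣m*n b (weight-∣ (k∣v ∘ suc)))

  weight-0 : ∀ m → weight {m} a b (λ _ → 0ℤ) ≡ 0ℤ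
  weight-0 m = weight-• {m} 0ℤ (λ _ → 0ℤ)

  -- The weight of eᵢ is the single monomial aᵐ⁻¹⁻ⁱ bⁱ, a product of cancellable factors.
  regular-weight-e : ∀ {N} → Regular N a → Regular N b → (i : Fin m) → Regular N (weight a b (e i))
  regular-weight-e {suc m} {N} ra rb zero = subst (Regular N) (sym eq) (regular-^ ra m)
    where
    eq : a ^ m * 1ℤ + b * weight {m} a b (λ _ → 0ℤ) ≡ a ^ m
    eq = begin
      a ^ m * 1ℤ + b * weight {m} a b (λ _ → 0ℤ) ≡⟨ cong₂ _+_ (*-identityʳ (a ^ m)) (cong (b *_) (weight-0 m)) ⟩
      a ^ m + b * 0ℤ                             ≡⟨ cong (_+_ (a ^ m)) (*-zeroʳ b) ⟩
      a ^ m + 0ℤ                                 ≡⟨ +-identityʳ (a ^ m) ⟩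
      a ^ m                                      ∎
  regular-weight-e {suc m} {N} ra rb (suc i) =
    subst (Regular N) (sym eq) (regular-* {y = b} rb (regular-weight-e ra rb i))
    where
    eq : a ^ m * 0ℤ + b * weight a b (e i) ≡ b * weight a b (e i)
    eq = trans (cong (_+ b * weight a b (e i)) (*-zeroʳ (a ^ m))) (+-identityˡ _)

  -- `c` has one entry more than `d`; its first and last entries are boundary values that are left
  -- free here.
  Orbit : Vector ℤ m → Vector ℤ (suc m) → Set
  Orbit d c = ∀ j → b * c (suc j) ≡ a * c (inject₁ j) + d j

  -- Multiplying the equation at j by aᵐ⁻¹⁻ʲ bʲ and summing telescopes. The induction replaces a c₀
  -- + d₀ by b c₁ and pulls out one factor b.
  orbit-weight : ∀ {d : Vector ℤ m} {c} → Orbit d c →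
                 a ^ m * c zero + weight a b d ≡ b ^ m * c (fromℕ m)
  orbit-weight {zero}  orb = +-identityʳ _
  orbit-weight {suc m} {d} {c} orb = begin
    a * a ^ m * c zero + (a ^ m * d zero + b * w)   ≡⟨ regroup a (a ^ m) (c zero) (d zero) (b * w) ⟩
    a ^ m * (a * c zero + d zero) + b * w           ≡⟨ cong (λ s → a ^ m * s + b * w) (sym (orb zero)) ⟩
    a ^ m * (b * c (suc zero)) + b * w              ≡⟨ factor (a ^ m) b (c (suc zero)) w ⟩
    b * (a ^ m * c (suc zero) + w)                  ≡⟨ cong (b *_) (orbit-weight {d = d ∘ suc} {c = c ∘ suc} (orb ∘ suc)) ⟩
    b * (b ^ m * c (fromℕ (suc m)))                 ≡⟨ *-assoc b (b ^ m) _ ⟨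
    b ^ suc m * c (fromℕ (suc m))                   ∎
    where
    w = weight a b (d ∘ suc)
    regroup : ∀ a x c d t → a * x * c + (x * d + t) ≡ x * (a * c + d) + t
    regroup = solve-∀
    factor : ∀ x b c w → x * (b * c) + b * w ≡ b * (x * c + w)
    factor = solve-∀

  -- Converse of `orbit-weight`, building the orbit forward. Modulo b the boundary equation says
  -- that a power of a times a x + d₀ vanishes, so b divides a x + d₀, and the quotient is the next
  -- entry.
  orbit-exists : .{{_ : NonZero b}} → Regular b a → (d : Vector ℤ m) (x t : ℤ) →
                 a ^ m * x + weight a b d ≡ b ^ m * t →
                 ∃ λ c → c zero ≡ x × c (fromℕ m) ≡ t × Orbit d c
  orbit-exists {zero} r d x t eq = (λ _ → x) , refl , x≡t , λ ()
    where
    x≡t : x ≡ t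
    x≡t = begin
      x             ≡⟨ *-identityˡ x ⟨
      1ℤ * x        ≡⟨ +-identityʳ (1ℤ * x) ⟨
      1ℤ * x + 0ℤ   ≡⟨ eq ⟩
      1ℤ * t        ≡⟨ *-identityˡ t ⟩
      t             ∎
  orbit-exists {suc m} r d x t eq = x ∷ c , refl , proj₁ (proj₂ (proj₂ ih)) , λ where
      zero    → trans (cong (b *_) (proj₁ (proj₂ ih))) (trans (*-comm b y) (sym eq′))
      (suc j) → proj₂ (proj₂ (proj₂ ih)) j
    where
    w = weight a b (d ∘ suc)

    regroup : ∀ a y x d t → (a * x + d) * y ≡ a * y * x + (y * d + t) - t
    regroup = solve-∀

    factor : ∀ b y t w → b * y * t - b * w ≡ (y * t - w) * b
    factor = solve-∀

    step : b ∣ a * x + d zero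
    step = regular-^ r m (a * x + d zero) (divides (b ^ m * t - w) (begin
      (a * x + d zero) * a ^ m                           ≡⟨ regroup a (a ^ m) x (d zero) (b * w) ⟩
      a * a ^ m * x + (a ^ m * d zero + b * w) - b * w   ≡⟨ cong (_- b * w) eq ⟩
      b * b ^ m * t - b * w                              ≡⟨ factor b (b ^ m) t w ⟩
      (b ^ m * t - w) * b                                ∎))

    y = quotient step

    eq′ : a * x + d zero ≡ y * b
    eq′ = _∣_.equality step

    regroup₁ : ∀ b y c w → b * (y * c + w) ≡ y * (c * b) + b * w
    regroup₁ = solve-∀

    regroup₂ : ∀ a y x d t → y * (a * x + d) + t ≡ a * y * x + (y * d + t)
    regroup₂ = solve-∀

    -- Cancelling one factor b from the boundary equation leaves the same equation for the tail of
    -- `d`, started at `y`.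
    ih = orbit-exists r (d ∘ suc) y t (*-cancelˡ-≡ b _ _ (begin
      b * (a ^ m * y + w)                         ≡⟨ regroup₁ b (a ^ m) y w ⟩
      a ^ m * (y * b) + b * w                     ≡⟨ cong (λ s → a ^ m * s + b * w) (sym eq′) ⟩
      a ^ m * (a * x + d zero) + b * w            ≡⟨ regroup₂ a (a ^ m) x (d zero) (b * w) ⟩
      a * a ^ m * x + (a ^ m * d zero + b * w)    ≡⟨ eq ⟩
      b * b ^ m * t                               ≡⟨ *-assoc b (b ^ m) t ⟩
      b * (b ^ m * t)                             ∎))

    c = proj₁ ih

-- The image of the matrix as a divisibility condition on the weight.

sum-linear : ∀ x y (f g : Vector ℤ m) →
             sum (λ k → x * f k + y * g k) ≡ x * sum f + y * sum g
sum-linear {zero}  x y f g = sym (cong₂ _+_ (*-zeroʳ x) (*-zeroʳ y))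
sum-linear {suc m} x y f g = trans
  (cong (_+_ (x * f zero + y * g zero)) (sum-linear x y (f ∘ suc) (g ∘ suc)))
  (distrib x y (f zero) (g zero) (sum (f ∘ suc)) (sum (g ∘ suc)))
  where
  distrib : ∀ x y s t s′ t′ → x * s + y * t + (x * s′ + y * t′) ≡ x * (s + s′) + y * (t + t′)
  distrib = solve-∀

sum-zero : (v : Vector ℤ m) → sum (λ k → 0ℤ * v k) ≡ 0ℤ
sum-zero {zero}  v = refl
sum-zero {suc m} v = cong₂ _+_ (*-zeroˡ (v zero)) (sum-zero (v ∘ suc))

sum-e : (v : Vector ℤ m) (j : Fin m) → sum (λ k → e k j * v k) ≡ v j
sum-e v zero = trans (cong₂ _+_ (*-identityˡ (v zero)) (sum-zero (v ∘ suc))) (+-identityʳ (v zero))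
sum-e v (suc j) = trans (cong₂ _+_ (*-zeroˡ (v zero)) (sum-e (v ∘ suc) j)) (+-identityˡ _)

module _ (p q : ℕ) where
  open ≡-Reasoning

  column-inject₁ : ∀ (k : Fin m) j →
    column p q (suc m) (inject₁ k) j ≡ + q * e (inject₁ k) j - + p * e (suc k) j
  column-inject₁ k j rewrite view-inject₁ k = refl

  column-fromℕ : ∀ m j →
    column p q (suc m) (fromℕ m) j ≡ + q * e (fromℕ m) j + + p * e zero j
  column-fromℕ m j rewrite view-fromℕ m = refl

  -- Prepending −cₘ to c makes the wrap-around column look like the others.
  A-row : (c : Vector ℤ (suc m)) (j : Fin (suc m)) →
    (A p q (suc m) · c) j ≡ + q * c j - + p * (- c (fromℕ m) ∷ c) (inject₁ j)
  A-row {m} c j = begin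
    (A p q (suc m) · c) j
      ≡⟨ sum-init-last (λ k → A p q (suc m) j k * c k) ⟩
    sum (λ k → column p q (suc m) (inject₁ k) j * c (inject₁ k)) + column p q (suc m) (fromℕ m) j * cₘ
      ≡⟨ cong₂ _+_ (sum-cong-≗ λ k → trans (cong (_* c (inject₁ k)) (column-inject₁ k j)) (expand₁ (+ q) (+ p) (e (inject₁ k) j) (e (suc k) j) (c (inject₁ k))))
                   (trans (cong (_* cₘ) (column-fromℕ m j)) (expand₂ (+ q) (+ p) (e (fromℕ m) j) (e zero j) cₘ)) ⟩
    sum (λ k → + q * f k + - + p * g k) + (+ q * (e (fromℕ m) j * cₘ) + - + p * (e zero j * - cₘ))
      ≡⟨ cong (λ s → s + (+ q * (e (fromℕ m) j * cₘ) + - + p * (e zero j * - cₘ))) (sum-linear (+ q) (- + p) f g) ⟩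
    + q * sum f + - + p * sum g + (+ q * (e (fromℕ m) j * cₘ) + - + p * (e zero j * - cₘ))
      ≡⟨ regroup (+ q) (+ p) (sum f) (sum g) (e (fromℕ m) j * cₘ) (e zero j * - cₘ) ⟩
    + q * (sum f + e (fromℕ m) j * cₘ) - + p * (e zero j * - cₘ + sum g)
      ≡⟨ cong₂ (λ s t → + q * s - + p * t)
               (trans (sym (sum-init-last (λ k → e k j * c k))) (sum-e c j))
               -- By the definition of `sum`, the term at `zero` followed by `sum g` is the sum over
               -- the shifted vector.
               (sum-e (λ k → (- cₘ ∷ c) (inject₁ k)) j) ⟩
    + q * c j - + p * (- cₘ ∷ c) (inject₁ j) ∎
    where
    cₘ = c (fromℕ m)
    f g : Vector ℤ m
    f k = e (inject₁ k) j * c (inject₁ k)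
    g k = e (suc k) j * c (inject₁ k)
    expand₁ : ∀ x y s t z → (x * s - y * t) * z ≡ x * (s * z) + - y * (t * z)
    expand₁ = solve-∀
    expand₂ : ∀ x y s t z → (x * s + y * t) * z ≡ x * (s * z) + - y * (t * - z)
    expand₂ = solve-∀
    regroup : ∀ x y s t s′ t′ → x * s + - y * t + (x * s′ + - y * t′) ≡ x * (s + s′) - y * (t′ + t)
    regroup = solve-∀

  -- By `A-row`, the coefficients with -cₘ prepended form an orbit for `v` from -cₘ to cₘ, and
  -- `orbit-weight` exhibits cₘ as the quotient.
  image⇒∣weight : {v : Vector ℤ (suc m)} → v ∈Image A p q (suc m) →
                  (+ p) ^ suc m + (+ q) ^ suc m ∣ weight (+ p) (+ q) v
  image⇒∣weight {m} {v} (c , v≡Ac) = divides cₘ (begin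
    weight (+ p) (+ q) v                                ≡⟨ isolate P (weight (+ p) (+ q) v) cₘ ⟩
    P * cₘ + (P * (- cₘ) + weight (+ p) (+ q) v)        ≡⟨ cong (_+_ (P * cₘ)) (orbit-weight (+ p) (+ q) {d = v} {c = - cₘ ∷ c} orb) ⟩
    P * cₘ + Q * cₘ                                     ≡⟨ *-distribʳ-+ cₘ P Q ⟨
    (P + Q) * cₘ                                        ≡⟨ *-comm (P + Q) cₘ ⟩
    cₘ * (P + Q)                                        ∎)
    where
    P = (+ p) ^ suc m
    Q = (+ q) ^ suc m
    cₘ = c (fromℕ m)
    isolate : ∀ x w t → w ≡ x * t + (x * (- t) + w)
    isolate = solve-∀
    cancel : ∀ s t → s ≡ t + (s - t)
    cancel = solve-∀
    orb : Orbit (+ p) (+ q) v (- cₘ ∷ c)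
    orb j = begin
      + q * c j             ≡⟨ cancel (+ q * c j) pc ⟩
      pc + (+ q * c j - pc) ≡⟨ cong (_+_ pc) (sym (trans (v≡Ac j) (A-row c j))) ⟩
      pc + v j              ∎
      where pc = + p * (- cₘ ∷ c) (inject₁ j)

  -- The quotient `t` prescribes an orbit from -t to t. Its first entry is minus its last, so
  -- dropping the first entry leaves coefficients of the columns.
  ∣weight⇒image : .{{_ : ℕ.NonZero q}} → ℕ.Coprime q p → {v : Vector ℤ (suc m)} →
                  (+ p) ^ suc m + (+ q) ^ suc m ∣ weight (+ p) (+ q) v → v ∈Image A p q (suc m)
  ∣weight⇒image {m} cop {v} (divides t eq) = c ∘ suc , λ j → begin
      v j
        ≡⟨ cancel (v j) (+ p * c (inject₁ j)) ⟩
      + p * c (inject₁ j) + v j - + p * c (inject₁ j)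
        ≡⟨ cong₂ (λ s t → s - + p * t) (sym (orb j)) (prepend j) ⟩
      + q * c (suc j) - + p * (- c (fromℕ (suc m)) ∷ c ∘ suc) (inject₁ j)
        ≡⟨ A-row (c ∘ suc) j ⟨
      (A p q (suc m) · (c ∘ suc)) j
        ∎
    where
    isolate : ∀ x y t → x * (- t) + t * (x + y) ≡ y * t
    isolate = solve-∀

    solution = orbit-exists (+ p) (+ q) (coprime⇒regular cop) v (- t) t
      (trans (cong (_+_ ((+ p) ^ suc m * - t)) eq) (isolate ((+ p) ^ suc m) ((+ q) ^ suc m) t))

    c = proj₁ solution
    orb = proj₂ (proj₂ (proj₂ solution))

    cancel : ∀ s t → s ≡ t + s - t
    cancel = solve-∀

    prepend : ∀ j → c (inject₁ j) ≡ (- c (fromℕ (suc m)) ∷ c ∘ suc) (inject₁ j)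
    prepend zero    = trans (proj₁ (proj₂ solution)) (cong -_ (sym (proj₁ (proj₂ (proj₂ solution)))))
    prepend (suc j) = refl

-- Pigeonhole and complete residue systems.

-- Punching a missed value out of the codomain would leave an injection of `suc n` elements into
-- `n`.
injective⇒surjective : {f : Fin n → Fin n} → Injective _≡_ _≡_ f → ∀ y → ∃ λ x → f x ≡ y
injective⇒surjective {suc n} {f} inj y with any? (λ x → f x ≟ y)
... | yes hit = hit
... | no miss = contradiction
  (injective⇒≤ {f = λ x → punchOut (y≢f x)} (λ {x} {x′} eq → inj (punchOut-injective (y≢f x) (y≢f x′) eq)))
  ℕ.1+n≰n
  where
  y≢f : ∀ x → y ≢ f x
  y≢f x y≡fx = miss (x , sym y≡fx)

finToFun-injective : (r r′ : Fin (n ℕ.^ m)) → finToFun {n} {m} r ≗ finToFun r′ → r ≡ r′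
finToFun-injective {n} {m} r r′ eq = begin
  r                               ≡⟨ funToFin-finToFin {m} {n} r ⟨
  funToFin (finToFun {n} {m} r)   ≡⟨ funToFin-cong eq ⟩
  funToFin (finToFun {n} {m} r′)  ≡⟨ funToFin-finToFin {m} {n} r′ ⟩
  r′                              ∎
  where
  open ≡-Reasoning
  funToFin-cong : ∀ {m} {f g : Fin m → Fin n} → f ≗ g → funToFin f ≡ funToFin g
  funToFin-cong {zero}  f≗g = refl
  funToFin-cong {suc m} f≗g = cong₂ combine (f≗g zero) (funToFin-cong (f≗g ∘ suc))

digit-difference : ∀ {s s′} (i : Fin s) (j : Fin s′) →
                   - + s′ < + toℕ i - + toℕ j × + toℕ i - + toℕ j < + s
digit-difference {s} {s′} i j =
  (begin-strict
    - + s′               <⟨ neg-mono-< (+<+ (toℕ<n j)) ⟩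
    - + toℕ j            ≤⟨ i≤j+i (- + toℕ j) (+ toℕ i) ⟩
    + toℕ i - + toℕ j    ∎) ,
  (begin-strict
    + toℕ i - + toℕ j    ≤⟨ i-j≤i (+ toℕ i) (+ toℕ j) ⟩
    + toℕ i              <⟨ +<+ (toℕ<n i) ⟩
    + s                  ∎)
  where open ≤-Reasoning

module Residues (N : ℕ) .{{_ : ℕ.NonZero N}} where

  residue : ℤ → Fin N
  residue z = fromℕ< (n%ℕd<d z N)

  ∣-residue : ∀ z → + N ∣ z - + toℕ (residue z)
  ∣-residue z = divides (z /ℕ N) (begin
    z - + toℕ (residue z)                         ≡⟨ cong (λ r → z - + r) (toℕ-fromℕ< (n%ℕd<d z N)) ⟩
    z - + (z %ℕ N)                                ≡⟨ cong (_- + (z %ℕ N)) (a≡a%ℕn+[a/ℕn]*n z N) ⟩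
    + (z %ℕ N) + (z /ℕ N) * + N - + (z %ℕ N)      ≡⟨ cancel (+ (z %ℕ N)) ((z /ℕ N) * + N) ⟩
    (z /ℕ N) * + N                                ∎)
    where
    open ≡-Reasoning
    cancel : ∀ r s → r + s - r ≡ s
    cancel = solve-∀

  residue-≡⇒∣ : ∀ y z → residue y ≡ residue z → + N ∣ y - z
  residue-≡⇒∣ y z eq = subst (+ N ∣_) (cancel y z (+ toℕ (residue z)))
    (∣m∣n⇒∣m-n (subst (λ r → + N ∣ y - + toℕ r) eq (∣-residue y)) (∣-residue z))
    where
    cancel : ∀ y z r → y - r - (z - r) ≡ y - z
    cancel = solve-∀

  ∣-digits⇒≡ : (i j : Fin N) → + N ∣ + toℕ i - + toℕ j → i ≡ j
  ∣-digits⇒≡ i j N∣ = toℕ-injective (+-injective (i-j≡0⇒i≡j (+ toℕ i) (+ toℕ j) (∣i∣≡0⇒i≡0 (small (∣⇒∣ᵤ N∣) bound))))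
    where
    bound : ∣ + toℕ i - + toℕ j ∣ ℕ.< N
    bound = subst (λ s → ∣ s ∣ ℕ.< N) (sym (m-n≡m⊖n (toℕ i) (toℕ j)))
      (ℕ.≤-<-trans (∣m⊝n∣≤m⊔n (toℕ i) (toℕ j)) (ℕ.⊔-pres-<m (toℕ<n i) (toℕ<n j)))
    small : ∀ {k} → N ℕ.∣ k → k ℕ.< N → k ≡ 0
    small {zero}  _   _   = refl
    small {suc k} N∣k k<N = contradiction (ℕ.∣⇒≤ N∣k) (ℕ.<⇒≱ k<N)

  -- Reducing the N pairwise incongruent values gives an injective self-map of `Fin N`, hence a
  -- surjective one.
  complete-residues : (f : Fin N → ℤ) → (∀ i j → + N ∣ f i - f j → i ≡ j) →
                      ∀ z → ∃ λ i → + N ∣ z - f i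
  complete-residues f inj z =
    let i , eq = injective⇒surjective {f = λ i → residue (f i)}
                   (λ {i} {j} eq → inj i j (residue-≡⇒∣ (f i) (f j) eq)) (residue z)
    in i , residue-≡⇒∣ z (f i) (sym eq)

  -- The multiples i z with 0 ≤ i < N are pairwise incongruent, so one of them is congruent to 1.
  regular⇒inverse : ∀ {z} → Regular (+ N) z → ∃ λ z⁻¹ → + N ∣ 1ℤ - z⁻¹ * z
  regular⇒inverse {z} rz =
    let i , h = complete-residues (λ i → + toℕ i * z)
                  (λ i j h → ∣-digits⇒≡ i j (rz (+ toℕ i - + toℕ j) (subst (+ N ∣_) (factor (+ toℕ i) (+ toℕ j) z) h))) 1ℤ
    in + toℕ i , h
    where
    factor : ∀ x y z → x * z - y * z ≡ (x - y) * z
    factor = solve-∀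

-- Orbits with small increments keep their sign.

module Kernel (p q : ℕ) .{{_ : ℕ.NonZero q}} where

  module _ {x x′ d} (step : + q * x′ ≡ + p * x + d) where
    open ≤-Reasoning

    -- Since q x′ ≥ d > -q, cancelling q gives x′ > -1, and integrality does the rest.
    0≤x⇒0≤x′ : - + q < d → 0ℤ ≤ x → 0ℤ ≤ x′
    0≤x⇒0≤x′ lo 0≤x = i<j⇒suc[i]≤j (*-cancelˡ-<-nonNeg { -1ℤ} {x′} (+ q) (begin-strict
      + q * -1ℤ      ≡⟨ *-comm (+ q) -1ℤ ⟩
      -1ℤ * + q      ≡⟨ -1*i≡-i (+ q) ⟩
      - + q          <⟨ lo ⟩
      d              ≡⟨ +-identityˡ d ⟨
      0ℤ + d         ≡⟨ cong (λ s → s + d) (*-zeroʳ (+ p)) ⟨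
      + p * 0ℤ + d   ≤⟨ +-monoˡ-≤ d (*-monoˡ-≤-nonNeg (+ p) 0≤x) ⟩
      + p * x + d    ≡⟨ step ⟨
      + q * x′       ∎))

    -- If x′ ≥ x + 1, then q x + q ≤ q x′ = p x + d < q x + q.
    0≤x⇒x′≤x : p ℕ.≤ q → d < + q → 0ℤ ≤ x → x′ ≤ x
    0≤x⇒x′≤x p≤q hi 0≤x = ≮⇒≥ λ x<x′ → <-irrefl refl (begin-strict
      + q * x′         ≡⟨ step ⟩
      + p * x + d      <⟨ +-monoʳ-< (+ p * x) hi ⟩
      + p * x + + q    ≤⟨ +-monoˡ-≤ (+ q) (*-monoʳ-≤-nonNeg x {{nonNegative 0≤x}} (+≤+ p≤q)) ⟩
      + q * x + + q    ≡⟨ +-comm (+ q * x) (+ q) ⟩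
      + q + + q * x    ≡⟨ *-suc (+ q) x ⟨
      + q * (1ℤ + x)   ≤⟨ *-monoˡ-≤-nonNeg (+ q) (i<j⇒suc[i]≤j x<x′) ⟩
      + q * x′         ∎)

    -- Here p x ≥ p outweighs d > -p, so q x′ is positive.
    1≤x⇒1≤x′ : - + p < d → 1ℤ ≤ x → 1ℤ ≤ x′
    1≤x⇒1≤x′ lo 1≤x = i<j⇒suc[i]≤j (*-cancelˡ-<-nonNeg {0ℤ} {x′} (+ q) (begin-strict
      + q * 0ℤ          ≡⟨ *-zeroʳ (+ q) ⟩
      0ℤ                ≡⟨ +-inverseʳ (+ p) ⟨
      + p - + p         <⟨ +-monoʳ-< (+ p) lo ⟩
      + p + d           ≡⟨ cong (λ s → s + d) (*-identityʳ (+ p)) ⟨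
      + p * 1ℤ + d      ≤⟨ +-monoˡ-≤ d (*-monoˡ-≤-nonNeg (+ p) 1≤x) ⟩
      + p * x + d       ≡⟨ step ⟨
      + q * x′          ∎))

    x≤0⇒x′≤0 : d < + q → x ≤ 0ℤ → x′ ≤ 0ℤ
    x≤0⇒x′≤0 hi x≤0 = ≮⇒≥ λ 0<x′ → <-irrefl refl (begin-strict
      + q * x′         ≡⟨ step ⟩
      + p * x + d      ≤⟨ +-monoˡ-≤ d (*-monoˡ-≤-nonNeg (+ p) x≤0) ⟩
      + p * 0ℤ + d     ≡⟨ cong (λ s → s + d) (*-zeroʳ (+ p)) ⟩
      0ℤ + d           ≡⟨ +-identityˡ d ⟩
      d                <⟨ hi ⟩
      + q              ≡⟨ *-identityʳ (+ q) ⟨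
      + q * 1ℤ         ≤⟨ *-monoˡ-≤-nonNeg (+ q) (i<j⇒suc[i]≤j 0<x′) ⟩
      + q * x′         ∎)

  norm : ℕ → ℤ
  norm m = (+ p) ^ m + (+ q) ^ m

  module _ (r : Regular (+ q) (+ p)) where

    private
      isolate : ∀ x y t → x * (- t) + t * (x + y) ≡ y * t
      isolate = solve-∀

      shift : ∀ x y t w → x * (- t) + w ≡ x * (- t) + ((w - y) + y)
      shift = solve-∀

      isolate-shifted : ∀ x y t → x * (- t) + (t * (x + y) + y) ≡ y * (1ℤ + t)
      isolate-shifted = solve-∀

      cancel : ∀ t → - t + (1ℤ + t) ≡ 1ℤ
      cancel = solve-∀

      -- The orbit runs from -t ≥ 0 to t, stays nonnegative and never increases. Its end gives t ≥
      -- 0, so the interval from 0 to -t that contains it collapses to 0.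
      kernel-trivial⁺ : p ℕ.≤ q → (v : Vector ℤ m) → (∀ j → - + q < v j × v j < + q) →
                        ∀ t → 0ℤ ≤ - t → weight (+ p) (+ q) v ≡ t * norm m → ∀ j → v j ≡ 0ℤ
      kernel-trivial⁺ {m} p≤q v bounds t 0≤-t eq
        with c , c₀ , cₗ , orb ← orbit-exists (+ p) (+ q) r v (- t) t
               (trans (cong (_+_ ((+ p) ^ m * - t)) eq) (isolate ((+ p) ^ m) ((+ q) ^ m) t))
        = λ j → begin
          v j                           ≡⟨ add-sub (v j) (+ p * c (inject₁ j)) ⟩
          + p * c (inject₁ j) + v j - + p * c (inject₁ j) ≡⟨ cong (_- + p * c (inject₁ j)) (orb j) ⟨
          + q * c (suc j) - + p * c (inject₁ j) ≡⟨ cong₂ (λ s t → + q * s - + p * t) (c≡0 (suc j)) (c≡0 (inject₁ j)) ⟩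
          + q * 0ℤ - + p * 0ℤ           ≡⟨ cong₂ _-_ (*-zeroʳ (+ q)) (*-zeroʳ (+ p)) ⟩
          0ℤ                            ∎
        where
        open ≡-Reasoning
        add-sub : ∀ s t → s ≡ t + s - t
        add-sub = solve-∀
        between : ∀ j → 0ℤ ≤ c j × c j ≤ - t
        between = <-weakInduction (λ j → 0ℤ ≤ c j × c j ≤ - t)
          (subst (0ℤ ≤_) (sym c₀) 0≤-t , ≤-reflexive c₀)
          λ j (0≤x , x≤-t) →
            0≤x⇒0≤x′ (orb j) (proj₁ (bounds j)) 0≤x ,
            ≤-trans (0≤x⇒x′≤x (orb j) p≤q (proj₂ (bounds j)) 0≤x) x≤-t
        -t≤0 : - t ≤ 0ℤ
        -t≤0 = neg-mono-≤ (subst (0ℤ ≤_) cₗ (proj₁ (between (fromℕ m))))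
        c≡0 : ∀ j → c j ≡ 0ℤ
        c≡0 j = ≤-antisym (≤-trans (proj₂ (between j)) -t≤0) (proj₁ (between j))

    -- Negating `v` negates the quotient `t`, which reduces to one sign of it.
    kernel-trivial : p ℕ.≤ q → (v : Vector ℤ m) → (∀ j → - + q < v j × v j < + q) →
                     norm m ∣ weight (+ p) (+ q) v → ∀ j → v j ≡ 0ℤ
    kernel-trivial {m} p≤q v bounds (divides t eq) with ≤-total 0ℤ (- t)
    ... | inj₁ 0≤-t = kernel-trivial⁺ p≤q v bounds t 0≤-t eq
    ... | inj₂ -t≤0 = λ j → neg-injective (trans (sym (-1*i≡-i (v j))) (kernel-trivial⁺ p≤q (-1ℤ • v)
      (λ j → subst (λ s → - + q < s × s < + q) (sym (-1*i≡-i (v j)))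
        (neg-mono-< (proj₂ (bounds j)) ,
         subst (- v j <_) (neg-involutive (+ q)) (neg-mono-< (proj₁ (bounds j)))))
      (- t) (neg-mono-≤ -t≤0)
      (begin
        weight (+ p) (+ q) (-1ℤ • v)    ≡⟨ weight-• (+ p) (+ q) -1ℤ v ⟩
        -1ℤ * weight (+ p) (+ q) v      ≡⟨ -1*i≡-i (weight (+ p) (+ q) v) ⟩
        - weight (+ p) (+ q) v          ≡⟨ cong -_ eq ⟩
        - (t * norm m)                  ≡⟨ neg-distribˡ-* t (norm m) ⟩
        - t * norm m                    ∎) j))
      where open ≡-Reasoning

    -- The orbit would run from -t to 1 + t, two numbers with sum 1. As the orbit preserves both ≤ 0
    -- and ≥ 1, that sum would be at most 0 or at least 2.
    shifted-kernel-empty : (v : Vector ℤ m) → (∀ j → - + p < v j × v j < + q) →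
                           ¬ norm m ∣ weight (+ p) (+ q) v - (+ q) ^ m
    shifted-kernel-empty {m} v bounds (divides t eq)
      with c , c₀ , cₗ , orb ← orbit-exists (+ p) (+ q) r v (- t) (1ℤ + t)
             (trans (shift ((+ p) ^ m) ((+ q) ^ m) t (weight (+ p) (+ q) v))
               (trans (cong (λ s → (+ p) ^ m * - t + (s + (+ q) ^ m)) eq) (isolate-shifted ((+ p) ^ m) ((+ q) ^ m) t)))
      with - t ≤? 0ℤ
    ... | yes -t≤0 = contradiction
      (+-mono-≤ -t≤0 (subst (_≤ 0ℤ) cₗ (<-weakInduction (λ j → c j ≤ 0ℤ) (subst (_≤ 0ℤ) (sym c₀) -t≤0)
        (λ j → x≤0⇒x′≤0 (orb j) (proj₂ (bounds j))) (fromℕ m))))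
      (λ h → 1≰0 (subst (_≤ 0ℤ) (cancel t) h))
      where
      1≰0 : ¬ 1ℤ ≤ 0ℤ
      1≰0 (+≤+ ())
    ... | no -t≰0 = contradiction
      (+-mono-≤ 1≤-t (subst (1ℤ ≤_) cₗ (<-weakInduction (λ j → 1ℤ ≤ c j) (subst (1ℤ ≤_) (sym c₀) 1≤-t)
        (λ j → 1≤x⇒1≤x′ (orb j) (proj₁ (bounds j))) (fromℕ m))))
      (λ h → 2≰1 (subst (1ℤ + 1ℤ ≤_) (cancel t) h))
      where
      1≤-t : 1ℤ ≤ - t
      1≤-t = i<j⇒suc[i]≤j (≰⇒> -t≰0)
      2≰1 : ¬ 1ℤ + 1ℤ ≤ 1ℤ
      2≰1 (+≤+ (ℕ.s≤s ()))

-- The least multiple of a unit vector in the lattice.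

-- A common divisor of `k` and the sum also divides lⁿ⁺¹, which is coprime to `k`.
coprime-sum : ∀ {k l} n → ℕ.Coprime k l → ℕ.Coprime (k ℕ.^ suc n ℕ.+ l ℕ.^ suc n) k
coprime-sum {k} {l} n c {d} (d∣sum , d∣k) = coprime-^ʳ c (suc n)
  (d∣k , ℕ.∣m+n∣m⇒∣n d∣sum (ℕ.∣m⇒∣m*n (k ℕ.^ n) d∣k))

module Lattice (p q m : ℕ) .{{_ : ℕ.NonZero p}} .{{_ : ℕ.NonZero q}} (coprime : ℕ.Coprime p q) where

  N : ℕ
  N = p ℕ.^ suc m ℕ.+ q ℕ.^ suc m

  instance
    N≢0 : ℕ.NonZero N
    N≢0 = ℕ.>-nonZero (ℕ.<-≤-trans (ℕ.m^n>0 p (suc m)) (ℕ.m≤m+n (p ℕ.^ suc m) (q ℕ.^ suc m)))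

  +N≡ : + N ≡ (+ p) ^ suc m + (+ q) ^ suc m
  +N≡ = trans (pos-+ (p ℕ.^ suc m) (q ℕ.^ suc m)) (cong₂ _+_ (pos-^ p (suc m)) (pos-^ q (suc m)))

  regular-p : Regular (+ N) (+ p)
  regular-p = coprime⇒regular (coprime-sum m coprime)

  regular-q : Regular (+ N) (+ q)
  regular-q = coprime⇒regular (subst (λ k → ℕ.Coprime k q) (ℕ.+-comm (q ℕ.^ suc m) (p ℕ.^ suc m))
    (coprime-sum m (ℕ.sym coprime)))

  W : ∀ {k} → Vector ℤ k → ℤ
  W = weight (+ p) (+ q)

  minimal-multiple : (i : Fin (suc m)) →
    IsMinimum (λ l → 1ℤ ≤ l × (l • e i) ∈Image A p q (suc m)) (+ N)
  minimal-multiple i = (+≤+ (ℕ.>-nonZero⁻¹ N) , N•e∈image) , minimal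
    where
    N•e∈image : (+ N • e i) ∈Image A p q (suc m)
    N•e∈image = ∣weight⇒image p q (ℕ.sym coprime) (divides (W (e i)) (begin
      W (+ N • e i)                                  ≡⟨ weight-• (+ p) (+ q) (+ N) (e i) ⟩
      + N * W (e i)                                  ≡⟨ *-comm (+ N) (W (e i)) ⟩
      W (e i) * + N                                  ≡⟨ cong (W (e i) *_) +N≡ ⟩
      W (e i) * ((+ p) ^ suc m + (+ q) ^ suc m)      ∎))
      where open ≡-Reasoning
    minimal : ∀ l → 1ℤ ≤ l × (l • e i) ∈Image A p q (suc m) → + N ≤ l
    minimal (+ suc l) (_ , l•e∈image) = +≤+ (ℕ.∣⇒≤ (∣⇒∣ᵤ
      (regular-weight-e (+ p) (+ q) regular-p regular-q i (+ suc l)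
        (subst₂ _∣_ (sym +N≡) (weight-• (+ p) (+ q) (+ suc l) (e i)) (image⇒∣weight p q l•e∈image)))))
    minimal (+ zero) (+≤+ () , _)

-- The two prototype cubes modulo the lattice, for p < q.

module Tiling (p q m : ℕ) .{{_ : ℕ.NonZero p}} .{{_ : ℕ.NonZero q}} (coprime : ℕ.Coprime p q) (p<q : p ℕ.< q) where

  open Lattice p q m coprime
  open Residues N
  open Kernel p q

  -- Kind zero is the small cube, based at q times the last unit vector
  -- (of weight qⁿ) modulo the lattice; kind one is the large cube, based at the origin.
  side-of : Fin 2 → ℕ
  side-of zero       = p
  side-of (suc zero) = q

  shift : Fin 2 → ℤ
  shift zero       = (+ q) ^ suc m
  shift (suc zero) = 0ℤ

  digits : ∀ {s k} → Vector (Fin s) k → Vector ℤ k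
  digits u j = + toℕ (u j)

  -- The weight, modulo `N`, of the point at offset `u` in the prototype cube of kind `k`.
  value : (k : Fin 2) → Vector (Fin (side-of k)) (suc m) → ℤ
  value k u = shift k + W (digits u)

  private
    ∣-resp : ∀ {x y} → x ≡ y → + N ∣ x → + N ∣ y
    ∣-resp = subst (+ N ∣_)

    ∣-flip : ∀ x y → + N ∣ x - y → + N ∣ y - x
    ∣-flip x y h = ∣-resp (flip x y) (∣m⇒∣-m h)
      where
      flip : ∀ x y → - (x - y) ≡ y - x
      flip = solve-∀

    ∣-chain : ∀ x y z → + N ∣ x - y → + N ∣ y - z → + N ∣ x - z
    ∣-chain x y z h h′ = ∣-resp (chain x y z) (∣m∣n⇒∣m+n h h′)
      where
      chain : ∀ x y z → x - y + (y - z) ≡ x - z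
      chain = solve-∀

    W-cong-mod : ∀ {k} (v w : Vector ℤ k) → v ≋ w [mod N ] → + N ∣ W v - W w
    W-cong-mod v w v≋w = ∣-resp (weight-⊖ (+ p) (+ q) v w) (weight-∣ (+ p) (+ q) v≋w)

    regular : Regular (+ q) (+ p)
    regular = coprime⇒regular (ℕ.sym coprime)

    -- The difference of the values is the weight of `digits u ⊖ digits u′` minus qⁿ. Digits of `u`
    -- are below q and those of `u′` below p, so the entries lie strictly between -p and q.
    disjoint : ∀ u u′ → ¬ + N ∣ value (suc zero) u - value zero u′
    disjoint u u′ h = shifted-kernel-empty regular (digits u ⊖ digits u′)
      (λ j → digit-difference (u j) (u′ j))
      (subst₂ _∣_ +N≡ (trans (regroup (W (digits u)) (W (digits u′)) ((+ q) ^ suc m))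
        (cong (_- (+ q) ^ suc m) (sym (weight-⊖ (+ p) (+ q) (digits u) (digits u′))))) h)
      where
      regroup : ∀ x y z → 0ℤ + x - (z + y) ≡ x - y - z
      regroup = solve-∀

  value-kind : ∀ k k′ u u′ → + N ∣ value k u - value k′ u′ → k ≡ k′
  value-kind zero       zero       u u′ h = refl
  value-kind (suc zero) (suc zero) u u′ h = refl
  value-kind (suc zero) zero       u u′ h = contradiction h (disjoint u u′)
  value-kind zero       (suc zero) u u′ h =
    contradiction (∣-flip (value zero u) (value (suc zero) u′) h) (disjoint u′ u)

  -- The shifts cancel, and as both sides are at most q, the digit differences satisfy the bounds of
  -- `kernel-trivial`.
  value-digits : ∀ k u u′ → + N ∣ value k u - value k u′ → u ≗ u′
  value-digits k u u′ h j = toℕ-injective (+-injective (i-j≡0⇒i≡j (+ toℕ (u j)) (+ toℕ (u′ j))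
    (kernel-trivial regular (ℕ.<⇒≤ p<q) (digits u ⊖ digits u′) bounds
      (subst₂ _∣_ +N≡ (trans (cancel (shift k) (W (digits u)) (W (digits u′)))
        (sym (weight-⊖ (+ p) (+ q) (digits u) (digits u′)))) h) j)))
    where
    cancel : ∀ s x y → s + x - (s + y) ≡ x - y
    cancel = solve-∀
    side-of≤q : ∀ k → side-of k ℕ.≤ q
    side-of≤q zero       = ℕ.<⇒≤ p<q
    side-of≤q (suc zero) = ℕ.≤-refl
    bounds : ∀ j → - + q < + toℕ (u j) - + toℕ (u′ j) × + toℕ (u j) - + toℕ (u′ j) < + q
    bounds j with lo , hi ← digit-difference (u j) (u′ j) =
      ≤-<-trans (neg-mono-≤ (+≤+ (side-of≤q k))) lo , <-≤-trans hi (+≤+ (side-of≤q k))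

  value-surjective : ∀ z → ∃ λ k → ∃ λ u → + N ∣ z - value k u
  value-surjective z =
    let i , h = complete-residues (λ i → val (split i)) val∘split-injective z
    in proj₁ (decode (split i)) , proj₂ (decode (split i)) , h
    where
    decode : Fin (p ℕ.^ suc m) ⊎ Fin (q ℕ.^ suc m) → ∃ λ k → Vector (Fin (side-of k)) (suc m)
    decode (inj₁ i) = zero , finToFun i
    decode (inj₂ i) = suc zero , finToFun i

    val : Fin (p ℕ.^ suc m) ⊎ Fin (q ℕ.^ suc m) → ℤ
    val s = value (proj₁ (decode s)) (proj₂ (decode s))

    val-injective : ∀ s s′ → + N ∣ val s - val s′ → s ≡ s′
    val-injective (inj₁ i) (inj₁ j) h = cong inj₁ (finToFun-injective {p} {suc m} i j (value-digits zero (finToFun i) (finToFun j) h))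
    val-injective (inj₂ i) (inj₂ j) h = cong inj₂ (finToFun-injective {q} {suc m} i j (value-digits (suc zero) (finToFun i) (finToFun j) h))
    val-injective (inj₁ i) (inj₂ j) h = contradiction (value-kind zero (suc zero) (finToFun i) (finToFun j) h) λ ()
    val-injective (inj₂ i) (inj₁ j) h = contradiction (value-kind (suc zero) zero (finToFun i) (finToFun j) h) λ ()

    -- `N` is pⁿ + qⁿ by definition, so an element of `Fin N` names a point of exactly one of the
    -- two cubes.
    split = splitAt (p ℕ.^ suc m) {q ℕ.^ suc m}

    val∘split-injective : ∀ i j → + N ∣ val (split i) - val (split j) → i ≡ j
    val∘split-injective i j h = begin
      i                                            ≡⟨ join-splitAt (p ℕ.^ suc m) (q ℕ.^ suc m) i ⟨
      join (p ℕ.^ suc m) (q ℕ.^ suc m) (split i)   ≡⟨ cong (join (p ℕ.^ suc m) (q ℕ.^ suc m)) (val-injective (split i) (split j) h) ⟩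
      join (p ℕ.^ suc m) (q ℕ.^ suc m) (split j)   ≡⟨ join-splitAt (p ℕ.^ suc m) (q ℕ.^ suc m) j ⟩
      j                                            ∎
      where open ≡-Reasoning

  -- Corners of the tiles.

  private
    inverse : ∃ λ z⁻¹ → + N ∣ 1ℤ - z⁻¹ * (+ p) ^ m
    inverse = regular⇒inverse (regular-^ regular-p m)

  -- The first coordinate of a corner is determined by the others through the
  -- congruence W ≡ shift k, as its coefficient pᵐ is invertible modulo N.
  corner-of : Fin 2 → Fin (N ℕ.^ m) → Vector ℤ (suc m)
  corner-of k r = proj₁ inverse * (shift k - + q * W (digits (finToFun {N} {m} r))) ∷ digits (finToFun {N} {m} r)

  -- Substituting the first coordinate leaves a multiple of 1 - z pᵐ, where z is the chosen inverse
  -- of pᵐ modulo `N`.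
  W-corner-of : ∀ k r → + N ∣ W (corner-of k r) - shift k
  W-corner-of k r = ∣-resp (regroup ((+ p) ^ m) (proj₁ inverse) (shift k) (+ q * W (digits (finToFun {N} {m} r))))
    (∣m⇒∣m*n (+ q * W (digits (finToFun {N} {m} r)) - shift k) (proj₂ inverse))
    where
    regroup : ∀ x y s t → (1ℤ - y * x) * (t - s) ≡ x * (y * (s - t)) + t - s
    regroup = solve-∀

  -- The index encodes the tail of `x` modulo `N`. Both vectors have weight `shift k`, so with
  -- congruent tails pᵐ times the difference of the heads vanishes modulo `N`, and pᵐ cancels.
  corner-of-surjective : ∀ k x → + N ∣ W x - shift k → ∃ λ r → x ≋ corner-of k r [mod N ]
  corner-of-surjective k x h = r , congruent
    where
    r = funToFin (residue ∘ x ∘ suc)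
    c = corner-of k r

    tails : ∀ j → + N ∣ x (suc j) - c (suc j)
    tails j = subst (λ i → + N ∣ x (suc j) - + toℕ i) (sym (finToFun-funToFin (residue ∘ x ∘ suc) j)) (∣-residue (x (suc j)))

    head : + N ∣ x zero - c zero
    head = regular-^ regular-p m (x zero - c zero) (∣-resp (*-comm ((+ p) ^ m) (x zero - c zero))
      (∣m+n∣n⇒∣m {m = (+ p) ^ m * (x zero - c zero)}
        (∣-resp (sym (weight-⊖ (+ p) (+ q) x c)) (∣-chain (W x) (shift k) (W c) h (∣-flip (W c) (shift k) (W-corner-of k r))))
        (∣n⇒∣m*n (+ q) (weight-∣ (+ p) (+ q) {v = λ j → x (suc j) - c (suc j)} tails))))

    congruent : x ≋ c [mod N ]
    congruent zero    = head
    congruent (suc j) = tails j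

  corner-of-injective : ∀ k r r′ → corner-of k r ≋ corner-of k r′ [mod N ] → r ≡ r′
  corner-of-injective k r r′ h = finToFun-injective {N} {m} r r′ λ j →
    ∣-digits⇒≡ (finToFun {N} {m} r j) (finToFun {N} {m} r′ j) (h (suc j))

  cube : Fin 2 → Fin (N ℕ.^ m) → Hypercube (suc m)
  cube k r = hypercube (corner-of k r) (side-of k)

  -- The corner contributes `shift k` whatever `r` is, so the weight of a point sees only kind and
  -- offset.
  ∈cube⇒value : ∀ y k r ((u , _) : y ∈ cube k r [mod N ]) → + N ∣ W y - value k u
  ∈cube⇒value y k r (u , y≋) = ∣-chain (W y) (W (c ⊕ digits u)) (value k u)
    (W-cong-mod y (c ⊕ digits u) y≋)
    (∣-resp (trans (cancel (W c) (shift k) (W (digits u))) (cong (_- value k u) (sym (weight-⊕ (+ p) (+ q) c (digits u)))))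
      (W-corner-of k r))
    where
    c = corner-of k r
    cancel : ∀ x s t → x - s ≡ x + t - (s + t)
    cancel = solve-∀

  -- The weight of `y` dictates kind and offset; subtracting the offset leaves a vector of weight
  -- `shift k`, hence a corner.
  cube-covers : ∀ y → ∃ λ k → ∃ λ r → y ∈ cube k r [mod N ]
  cube-covers y =
    let k , u , h = value-surjective (W y)
        r , y-u≋ = corner-of-surjective k (y ⊖ digits u)
          (∣-resp (trans (regroup (W y) (shift k) (W (digits u))) (cong (_- shift k) (sym (weight-⊖ (+ p) (+ q) y (digits u))))) h)
    in k , r , u , λ j → ∣-resp (move (y j) (+ toℕ (u j)) (corner-of k r j)) (y-u≋ j)
    where
    regroup : ∀ y s t → y - (s + t) ≡ y - t - s
    regroup = solve-∀
    move : ∀ y u c → y - u - c ≡ y - (c + u)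
    move = solve-∀

  -- Both memberships give congruent values, so kinds and offsets agree; subtracting the common
  -- offset from `y` makes the corners congruent.
  cube-unique : ∀ y k k′ r r′ → y ∈ cube k r [mod N ] → y ∈ cube k′ r′ [mod N ] → (k , r) ≡ (k′ , r′)
  cube-unique y k k′ r r′ y∈@(u , y≋) y∈′@(u′ , y≋′) =
    match k′ r′ u′ y≋′ same-value (value-kind k k′ u u′ same-value)
    where
    same-value : + N ∣ value k u - value k′ u′
    same-value = ∣-chain (value k u) (W y) (value k′ u′)
      (∣-flip (W y) (value k u) (∈cube⇒value y k r y∈)) (∈cube⇒value y k′ r′ y∈′)

    cancel : ∀ y c c′ t → y - (c′ + t) - (y - (c + t)) ≡ c - c′
    cancel = solve-∀

    -- Offsets of different kinds have different types, so the kinds are identified first, with all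
    -- that depends on `k′` generalised.
    match : ∀ k′ r′ u′ → y ≋ corner-of k′ r′ ⊕ digits u′ [mod N ] →
            + N ∣ value k u - value k′ u′ → k ≡ k′ → (k , r) ≡ (k′ , r′)
    match _ r′ u′ y≋′ h refl = cong (k ,_) (corner-of-injective k r r′ λ j → ∣-resp
      (cancel (y j) (corner-of k r j) (corner-of k r′ j) (+ toℕ (u j)))
      (∣m∣n⇒∣m-n
        (subst (λ i → + N ∣ y j - (corner-of k r′ j + + toℕ i)) (sym (value-digits k u u′ h j)) (y≋′ j))
        (y≋ j)))

  -- The family of tiles and its properties.

  kind : Fin (2 ℕ.* N ℕ.^ m) → Fin 2
  kind i = proj₁ (remQuot (N ℕ.^ m) i)

  index : Fin (2 ℕ.* N ℕ.^ m) → Fin (N ℕ.^ m)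
  index i = proj₂ (remQuot {2} (N ℕ.^ m) i)

  -- There are Nᵐ tiles of each kind, in accordance with the volume count Nᵐ (pⁿ + qⁿ) = Nⁿ for n =
  -- m + 1.
  tile : Fin (2 ℕ.* N ℕ.^ m) → Hypercube (suc m)
  tile i = cube (kind i) (index i)

  tile-combine : ∀ k r → tile (combine k r) ≡ cube k r
  tile-combine k r = cong (λ (k , r) → cube k r) (remQuot-combine k r)

  isTiling : IsTiling N tile
  isTiling y =
    let k , r , y∈ = cube-covers y in
    combine k r , subst (y ∈_[mod N ]) (sym (tile-combine k r)) y∈ , λ {i} y∈tile →
    trans (cong (λ (k , r) → combine k r) (cube-unique y k (kind i) r (index i) y∈ y∈tile)) (combine-remQuot {2} (N ℕ.^ m) i)

  hasSideLengths : HasSideLengths p q tile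
  hasSideLengths = (λ i → side-of-∈ (kind i))
    , (combine {2} zero r₀ , cong side (tile-combine zero r₀))
    , (combine {2} (suc zero) r₀ , cong side (tile-combine (suc zero) r₀))
    where
    side-of-∈ : ∀ k → side-of k ≡ p ⊎ side-of k ≡ q
    side-of-∈ zero       = inj₁ refl
    side-of-∈ (suc zero) = inj₂ refl
    -- Any index serves to show that both kinds occur; this one encodes the zero tail.
    r₀ : Fin (N ℕ.^ m)
    r₀ = funToFin {m} {N} (λ _ → residue 0ℤ)

  side-of-injective : ∀ k k′ → side-of k ≡ side-of k′ → k ≡ k′
  side-of-injective zero       zero       eq = refl
  side-of-injective (suc zero) (suc zero) eq = refl
  side-of-injective zero       (suc zero) eq = contradiction eq (ℕ.<⇒≢ p<q)
  side-of-injective (suc zero) zero       eq = contradiction (sym eq) (ℕ.<⇒≢ p<q)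

  -- Both sides are cancellable modulo `N`, so divisibility would give N ∣ 1, whereas N ≥ 2.
  N∤side-of : ∀ k → ¬ + N ∣ + side-of k
  N∤side-of k h = ℕ.<⇒≢ N>1 (sym (ℕ.∣1⇒≡1 (∣⇒∣ᵤ (regular-side k 1ℤ (∣-resp (sym (*-identityˡ (+ side-of k))) h)))))
    where
    regular-side : ∀ k → Regular (+ N) (+ side-of k)
    regular-side zero       = regular-p
    regular-side (suc zero) = regular-q
    N>1 : 1 ℕ.< N
    N>1 = ℕ.+-mono-≤ (ℕ.m^n>0 p (suc m)) (ℕ.m^n>0 q (suc m))

  -- Corners of one kind have equal weight modulo `N`, so `N` divides l W(eᵢ), and W(eᵢ) cancels.
  corner-difference⇒∣ : ∀ k r r′ i l → corner-of k r′ ⊖ corner-of k r ≋ l • e i [mod N ] → + N ∣ l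
  corner-difference⇒∣ k r r′ i l h = regular-weight-e (+ p) (+ q) regular-p regular-q i l
    (∣-resp (trans (cancel (W (c′ ⊖ c)) (W (l • e i))) (weight-• (+ p) (+ q) l (e i)))
      (∣m∣n⇒∣m-n same (W-cong-mod (c′ ⊖ c) (l • e i) h)))
    where
    c = corner-of k r
    c′ = corner-of k r′
    cancel : ∀ x y → x - (x - y) ≡ y
    cancel = solve-∀
    same : + N ∣ W (c′ ⊖ c)
    same = ∣-resp (sym (weight-⊖ (+ p) (+ q) c′ c))
      (∣-chain (W c′) (shift k) (W c) (W-corner-of k r′) (∣-flip (W c) (shift k) (W-corner-of k r)))

  isUnilateral : IsUnilateral N tile
  isUnilateral i j _ eq = unilateral (kind i) (kind j) (index i) (index j) (side-of-injective (kind i) (kind j) eq)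
    where
    unilateral : ∀ k k′ r r′ → k ≡ k′ → ¬ ShareFacet N (cube k r) (cube k′ r′)
    unilateral k _ r r′ refl (l , inj₁ h) = N∤side-of k (corner-difference⇒∣ k r r′ l (+ side-of k) h)
    unilateral k _ r r′ refl (l , inj₂ h) = N∤side-of k (∣-resp (neg-involutive (+ side-of k))
      (∣m⇒∣-m (corner-difference⇒∣ k r r′ l (- + side-of k) h)))

-- Both orders of p and q, and the theorem.

HasTiling : (n p q N : ℕ) → Set
HasTiling n p q N = ∃ λ (m : ℕ) → ∃ λ (T : Fin m → Hypercube n) →
  IsTiling N T × HasSideLengths p q T × IsUnilateral N T

tiling-swap : ∀ {n p q N} → HasTiling n p q N → HasTiling n q p N
tiling-swap (m , T , tiling , (sides , small , large) , unilateral) =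
  m , T , tiling , (swap ∘ sides , large , small) , unilateral

tiling-exists : ∀ m p q .{{_ : ℕ.NonZero p}} .{{_ : ℕ.NonZero q}} → ℕ.Coprime p q → p ≢ q →
                HasTiling (suc m) p q (p ℕ.^ suc m ℕ.+ q ℕ.^ suc m)
tiling-exists m p q coprime p≢q with ℕ.<-cmp p q
... | tri≈ _ p≡q _ = contradiction p≡q p≢q
... | tri< p<q _ _ = _ , tile , isTiling , hasSideLengths , isUnilateral
  where open Tiling p q m coprime p<q
-- The construction for the exchanged pair has modulus qⁿ + pⁿ, hence the transport along
-- commutativity.
... | tri> _ _ q<p = subst (HasTiling (suc m) p q) (ℕ.+-comm (q ℕ.^ suc m) (p ℕ.^ suc m))
  (tiling-swap (_ , tile , isTiling , hasSideLengths , isUnilateral))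
  where open Tiling q p m (ℕ.sym coprime) q<p

theorem4 : (n p q : ℕ) → n ℕ.≥ 2 → p ℕ.≥ 1 → q ℕ.≥ 1 → gcd p q ≡ 1 →
    ((i : Fin n) → IsMinimum (λ l → 1ℤ ≤ l × (l • e i) ∈Image A p q n) (+ (p ℕ.^ n ℕ.+ q ℕ.^ n)))
    × (p ≢ q → ∃ λ (m : ℕ) → ∃ λ (T : Fin m → Hypercube n) →
    IsTiling (p ℕ.^ n ℕ.+ q ℕ.^ n) T × HasSideLengths p q T × IsUnilateral (p ℕ.^ n ℕ.+ q ℕ.^ n) T)
theorem4 (suc m) p q _ p≥1 q≥1 gcd≡1 = Lattice.minimal-multiple p q m coprime , tiling-exists m p q coprime
  where
  coprime = ℕ.gcd≡1⇒coprime gcd≡1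
  instance
    p≢0 = ℕ.>-nonZero p≥1
    q≢0 = ℕ.>-nonZero q≥1
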